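{- Let $\mathcal V$ be a minimal variety of algebras (in an arbitrary finitary algebraic language). If $\mathcal V$ is abelian, then $\mathcal V$ is affine or $\mathcal V$ is strongly abelian.
   Context: An algebraic language consists of a set $F$ of operation symbols, each with a finite arity ($0$ allowed). An algebra has a nonempty universe $A$ and interprets each symbol of arity $k$ as an operation $A^k\to A$. A variety is the class of all algebras in a fixed language satisfying a given set of identities. A subvariety of $\mathcal V$ is a subclass of $\mathcal V$ that is a variety (in the same language). A variety is trivial if it consists of $1$-element algebras only. A variety is minimal if it is not trivial but every proper subvariety of it is trivial. A polynomial operation of $\mathbf A$ is a term operation of the algebra obtained from $\mathbf A$ by adding a constant symbol for each element of $A$. A $1,1$-matrix of an algebra $\mathbf A$ is a matrix of the form $$\begin{bmatrix} t(\mathbf a,\mathbf u) & t(\mathbf a,\mathbf v)\\ t(\mathbf b,\mathbf u) & t(\mathbf b,\mathbf v)\end{bmatrix}=\begin{bmatrix} p&q\\ r&s\end{bmatrix}\in A^{2\times 2},$$ where $t(\mathbf x,\mathbf y)$ is a polynomial operation of $\mathbf A$ and $\mathbf a,\mathbf b,\mathbf u,\mathbf v$ are tuples of elements of $A$ (of the appropriate lengths). The algebra $\mathbf A$ is abelian if for every $1,1$-matrix of $\mathbf A$, $p=q$ implies $r=s$. It is strongly rectangular if for every $1,1$-matrix, $q=r$ implies $r=s$. It is strongly abelian if it is abelian and strongly rectangular. It is affine if it is abelian and has a Maltsev operation, i.e. a ternary term operation $m$ with $m(x,y,y)=x=m(y,y,x)$ for all $x,y\in A$. A variety is abelian (respectively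 strongly abelian, affine) if all of its algebras are. -}

module Defs where

open import Data.Fin.Base using (Fin)
open import Data.Nat.Base using (ℕ)
open import Data.Product.Base using (Σ-syntax; _×_)
open import Data.Sum.Base using (_⊎_; inj₁; inj₂; [_,_])
open import Data.Vec.Functional using (Vector; []; _∷_)
open import Level using (Level; _⊔_; suc)
open import Relation.Binary.Bundles using (Setoid)
open import Relation.Binary.Core using (Rel)
open import Relation.Nullary.Negation.Core using (¬_)

private
  variable
    ℓ x : Level

record Language (ℓ : Level) : Set (suc ℓ) where
  field
    Symbol : Set ℓ
    arity  : Symbol → ℕ

open Language public

-- The universe is a setoid, so that quotient algebras exist; equality of
-- elements always means _≈_, which the operations are required to respect.
-- The element `inhabitant` records that the universe is nonempty; it is not
-- part of the algebraic structure.

record Algebra (L : Language ℓ) : Set (suc ℓ) where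
  field
    setoid : Setoid ℓ ℓ

  open Setoid setoid public

  field
    inhabitant : Carrier
    op         : (f : Symbol L) → Vector Carrier (arity L f) → Carrier
    op-cong    : ∀ f {as bs : Vector Carrier (arity L f)} →
                 (∀ i → as i ≈ bs i) → op f as ≈ op f bs

data Term (L : Language ℓ) (X : Set x) : Set (ℓ ⊔ x) where
  var : X → Term L X
  app : (f : Symbol L) → Vector (Term L X) (arity L f) → Term L X

module _ {L : Language ℓ} (A : Algebra L) where
  open Algebra A

  eval : {X : Set x} → Term L X → (X → Carrier) → Carrier
  eval (var y)    ρ = ρ y
  eval (app f ts) ρ = op f (λ i → eval (ts i) ρ)

  infix 4 _⊨_≈̇_

  _⊨_≈̇_ : Term L ℕ → Term L ℕ → Set ℓ
  _⊨_≈̇_ s t = ∀ ρ → eval s ρ ≈ eval t ρ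

-- A variety is presented by a set of identities, but the presentation is
-- used only through membership _∈_: inclusion below is inclusion of the
-- classes of models.

record Variety (L : Language ℓ) : Set (suc ℓ) where
  field
    Identity : Rel (Term L ℕ) ℓ

open Variety public

module _ {L : Language ℓ} where

  infix 4 _∈_ _⊆_ _⊂_

  _∈_ : Algebra L → Variety L → Set ℓ
  A ∈ V = ∀ s t → Identity V s t → A ⊨ s ≈̇ t

  _⊆_ : Variety L → Variety L → Set (suc ℓ)
  W ⊆ V = ∀ A → A ∈ W → A ∈ V

  _⊂_ : Variety L → Variety L → Set (suc ℓ)
  W ⊂ V = W ⊆ V × ¬ (V ⊆ W)

  Trivial : Variety L → Set (suc ℓ)
  Trivial V = ∀ A → A ∈ V → let open Algebra A in ∀ a b → a ≈ b

  Minimal : Variety L → Set (suc ℓ)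
  Minimal V = ¬ Trivial V × (∀ W → W ⊂ V → Trivial W)

withConstants : Language ℓ → Set ℓ → Language ℓ
withConstants L C = record
  { Symbol = Symbol L ⊎ C
  ; arity  = [ arity L , (λ _ → 0) ]
  }

module _ {L : Language ℓ} (A : Algebra L) where
  open Algebra A

  expansion : Algebra (withConstants L Carrier)
  expansion = record
    { setoid     = setoid
    ; inhabitant = inhabitant
    ; op         = λ { (inj₁ f) → op f ; (inj₂ c) _ → c }
    ; op-cong    = λ { (inj₁ f) → op-cong f ; (inj₂ c) _ → refl }
    }

  Polynomial : Set → Set ℓ
  Polynomial X = Term (withConstants L Carrier) X

  -- Matrix₁₁ p q r s says that [ p q ; r s ], read by rows, is a 1,1-matrix.

  Matrix₁₁ : (p q r s : Carrier) → Set ℓ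
  Matrix₁₁ p q r s =
    Σ[ m ∈ ℕ ] Σ[ n ∈ ℕ ] Σ[ t ∈ Polynomial (Fin m ⊎ Fin n) ]
    Σ[ a ∈ Vector Carrier m ] Σ[ b ∈ Vector Carrier m ]
    Σ[ u ∈ Vector Carrier n ] Σ[ v ∈ Vector Carrier n ]
      p ≈ eval expansion t [ a , u ] × q ≈ eval expansion t [ a , v ] ×
      r ≈ eval expansion t [ b , u ] × s ≈ eval expansion t [ b , v ]

  Abelian : Set ℓ
  Abelian = ∀ p q r s → Matrix₁₁ p q r s → p ≈ q → r ≈ s

  StronglyRectangular : Set ℓ
  StronglyRectangular = ∀ p q r s → Matrix₁₁ p q r s → q ≈ r → r ≈ s

  StronglyAbelian : Set ℓ
  StronglyAbelian = Abelian × StronglyRectangular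

  IsMaltsev : Term L (Fin 3) → Set ℓ
  IsMaltsev t = ∀ a b → m a b b ≈ a × m b b a ≈ a
    where
    m : Carrier → Carrier → Carrier → Carrier
    m a b c = eval A t (a ∷ b ∷ c ∷ [])

  Affine : Set ℓ
  Affine = Abelian × (Σ[ t ∈ Term L (Fin 3) ] IsMaltsev t)

module _ {L : Language ℓ} where

  AbelianVariety : Variety L → Set (suc ℓ)
  AbelianVariety V = ∀ A → A ∈ V → Abelian A

  StronglyAbelianVariety : Variety L → Set (suc ℓ)
  StronglyAbelianVariety V = ∀ A → A ∈ V → StronglyAbelian A

  AffineVariety : Variety L → Set (suc ℓ)
  AffineVariety V = ∀ A → A ∈ V → Affine A

{-# OPTIONS --safe #-}
module Submission where

-- Call K(u, w, w′) a perturbation of a term t(u) if K(u, w, w) ≈ t(u) in V, and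
-- call it inert if K(u, w, w′) ≈ t(u) in V.  Three facts give the dichotomy.
--
-- * If every perturbation of t(x, y) is inert, then t(a, v) ≈ t(b, u) implies
--   t(b, u) ≈ t(b, v).  Indeed, abelianness of free algebras modulo t(x, y) ≈ t(x, y′)
--   links t(x′, y) to t(x′, y′) by values of polynomials at these two terms, and
--   setting y′ = y in such a polynomial yields a perturbation of t.
-- * If every perturbation of a single variable is inert, then so is every perturbation
--   K of every t: otherwise K ≈ t implies x ≈ y by minimality; but a context C with
--   C[t] ≈ x or C[K] ≈ x is a term with range everything, whose perturbations come
--   from those of x, so the first fact shows that C[t] ≈ C[K] and x is never left.
-- * If T(z, w, w′) is a perturbation of z which is not inert, then T ≈ z implies
--   x ≈ y.  Perturbations of z act like the translations z + N(w − w′), and they can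
--   undo every step from x to y; the composite taking y to x is a Maltsev operation.
--
-- Chains of polynomial images are avoided: for an invariant P of such chains, one
-- works in the quotient by the largest congruence saturating P.

open import Defs
open import Axiom.ExcludedMiddle using (ExcludedMiddle)
open import Axiom.Extensionality.Propositional using (Extensionality)
open import Data.Bool.Base using (Bool; true; false)
open import Data.Fin.Base using (Fin; zero; suc; toℕ; _↑ˡ_; _↑ʳ_; splitAt)
open import Data.Fin.Properties using (+↔⊎; 2↔Bool; splitAt-↑ˡ; splitAt-↑ʳ)
open import Data.Maybe.Base using (Maybe; just; nothing; maybe′; fromMaybe)
open import Data.Nat.Base using (ℕ; zero; suc; _+_)
open import Data.Product.Base using (Σ-syntax; ∃; _×_; _,_; proj₁; proj₂; swap)
open import Data.Sum.Base using (_⊎_; inj₁; inj₂; [_,_])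
open import Data.Sum.Function.Propositional using (_⊎-↔_)
open import Data.Vec.Functional using (Vector; []; _∷_)
open import Function.Base using (_∘_; id; const)
open import Function.Bundles using (_↔_; module Inverse)
open import Function.Construct.Composition using (_↔-∘_)
open import Function.Construct.Identity using (↔-id)
open import Function.Construct.Symmetry using (↔-sym)
open import Level using (Level)
open import Relation.Binary.PropositionalEquality using (_≡_; refl; cong)
import Relation.Binary.PropositionalEquality as ≡
open import Relation.Nullary.Decidable.Core using (yes; no; decidable-stable)
open import Relation.Nullary.Negation.Core using (¬_; contradiction)

private
  variable
    ℓ x y : Level
    L : Language ℓ
    X : Set x
    Y : Set y

-- Substitution, finite supports and the term condition

infixl 9 _⟪_⟫

_⟪_⟫ : Term L X → (X → Term L Y) → Term L Y
var v    ⟪ σ ⟫ = σ v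
app f ts ⟪ σ ⟫ = app f (λ i → ts i ⟪ σ ⟫)

module _ (A : Algebra L) where
  open Algebra A renaming (refl to ≈-refl)

  eval-cong : (t : Term L X) {ρ σ : X → Carrier} →
              (∀ v → ρ v ≈ σ v) → eval A t ρ ≈ eval A t σ
  eval-cong (var v)    h = h v
  eval-cong (app f ts) h = op-cong f (λ i → eval-cong (ts i) h)

  eval-⟪⟫ : (t : Term L X) {σ : X → Term L Y} {ρ : Y → Carrier} →
            eval A (t ⟪ σ ⟫) ρ ≈ eval A t (λ v → eval A (σ v) ρ)
  eval-⟪⟫ (var v)    = ≈-refl
  eval-⟪⟫ (app f ts) = op-cong f (λ i → eval-⟪⟫ (ts i))

  -- Agreement is semantic because argument lists are functions, for which pointwise equality does
  -- not yield propositional equality without extensionality. Passing to finitely many variables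
  -- makes `Matrix₁₁` applicable to terms over any index set.
  Support : Term L X → Set _
  Support {X = X} t =
    Σ[ k ∈ ℕ ] Σ[ s ∈ Term L (Fin k) ] Σ[ θ ∈ (Fin k → X) ]
      (∀ ρ → eval A s (ρ ∘ θ) ≈ eval A t ρ)

  supports : ∀ n (ts : Vector (Term L X) n) → (∀ i → Support (ts i)) →
             Σ[ k ∈ ℕ ] Σ[ ss ∈ Vector (Term L (Fin k)) n ] Σ[ θ ∈ (Fin k → X) ]
               (∀ i ρ → eval A (ss i) (ρ ∘ θ) ≈ eval A (ts i) ρ)
  supports zero    ts h = 0 , (λ ()) , (λ ()) , λ ()
  supports (suc n) ts h with h zero | supports n (ts ∘ suc) (h ∘ suc)
  ... | k , s , θ , e | k′ , ss , θ′ , es =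
    k + k′ , ss″ , θ″ , e″
    where
    θ″ = [ θ , θ′ ] ∘ splitAt k
    ss″ : Vector (Term L (Fin (k + k′))) (suc n)
    ss″ zero    = s ⟪ (λ j → var (j ↑ˡ k′)) ⟫
    ss″ (suc i) = ss i ⟪ (λ j → var (k ↑ʳ j)) ⟫
    e″ : ∀ i ρ → eval A (ss″ i) (ρ ∘ θ″) ≈ eval A (ts i) ρ
    e″ zero ρ = trans (eval-⟪⟫ s)
      (trans (eval-cong s λ j → reflexive (cong (ρ ∘ [ θ , θ′ ]) (splitAt-↑ˡ k j k′))) (e ρ))
    e″ (suc i) ρ = trans (eval-⟪⟫ (ss i))
      (trans (eval-cong (ss i) λ j → reflexive (cong (ρ ∘ [ θ , θ′ ]) (splitAt-↑ʳ k k′ j))) (es i ρ))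

  support : (t : Term L X) → Support t
  support (var v) = 1 , var zero , const v , λ _ → ≈-refl
  support (app f ts) with supports _ ts (λ i → support (ts i))
  ... | k , ss , θ , h = k , app f ss , θ , λ ρ → op-cong f (λ i → h i ρ)

  toPolynomial : {Z : Set} → Term L X → (X → Z) → Polynomial A Z
  toPolynomial (var v)    κ = var (κ v)
  toPolynomial (app f ts) κ = app (inj₁ f) (λ i → toPolynomial (ts i) κ)

  eval-toPolynomial : {Z : Set} (t : Term L X) (κ : X → Z) (ρ : Z → Carrier) →
                      eval (expansion A) (toPolynomial t κ) ρ ≈ eval A t (ρ ∘ κ)
  eval-toPolynomial (var v)    κ ρ = ≈-refl
  eval-toPolynomial (app f ts) κ ρ = op-cong f (λ i → eval-toPolynomial (ts i) κ ρ)

  toTerm : {Z : Set} → Polynomial A Z → Term L (Carrier ⊎ Z)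
  toTerm (var v)           = var (inj₂ v)
  toTerm (app (inj₁ f) ts) = app f (λ i → toTerm (ts i))
  toTerm (app (inj₂ c) ts) = var (inj₁ c)

  eval-toTerm : {Z : Set} (t : Polynomial A Z) (ρ : Z → Carrier) →
                eval A (toTerm t) [ id , ρ ] ≈ eval (expansion A) t ρ
  eval-toTerm (var v)           ρ = ≈-refl
  eval-toTerm (app (inj₁ f) ts) ρ = op-cong f (λ i → eval-toTerm (ts i) ρ)
  eval-toTerm (app (inj₂ c) ts) ρ = ≈-refl

  -- Unlike in Matrix₁₁, the index set is arbitrary and each variable may
  -- choose on its own whether it is constant along rows or along columns.

  term-condition : Abelian A → (t : Term L X) (p q r s : X → Carrier) →
    (∀ v → (p v ≈ q v × r v ≈ s v) ⊎ (p v ≈ r v × q v ≈ s v)) →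
    eval A t p ≈ eval A t q → eval A t r ≈ eval A t s
  term-condition abelian t p q r s square p≈q with support t
  ... | k , t₀ , θ , h =
    abelian (eval A t p) (eval A t q) (eval A t r) (eval A t s)
      (k , k , toPolynomial t₀ κ , p ∘ θ , r ∘ θ , p ∘ θ , q ∘ θ ,
       corner p (λ j → p-corner (square (θ j))) ,
       corner q (λ j → q-corner (square (θ j))) ,
       corner r (λ j → r-corner (square (θ j))) ,
       corner s (λ j → s-corner (square (θ j))))
      p≈q
    where
    side : ∀ {v} j → (p v ≈ q v × r v ≈ s v) ⊎ (p v ≈ r v × q v ≈ s v) → Fin k ⊎ Fin k
    side j = [ const (inj₁ j) , const (inj₂ j) ]
    -- A variable constant along rows joins the first block, with values `p` and `r` in the two
    -- rows; any other joins the second, with values `p` and `q` in the two columns.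
    κ : Fin k → Fin k ⊎ Fin k
    κ j = side j (square (θ j))
    corner : ∀ ρ {a u : Fin k → Carrier} → (∀ j → ρ (θ j) ≈ [ a , u ] (κ j)) →
             eval A t ρ ≈ eval (expansion A) (toPolynomial t₀ κ) [ a , u ]
    corner ρ e = trans (sym (h ρ)) (trans (eval-cong t₀ e) (sym (eval-toPolynomial t₀ κ _)))
    p-corner : ∀ {j} sq → p (θ j) ≈ [ p ∘ θ , p ∘ θ ] (side j sq)
    p-corner (inj₁ _) = ≈-refl
    p-corner (inj₂ _) = ≈-refl
    q-corner : ∀ {j} sq → q (θ j) ≈ [ p ∘ θ , q ∘ θ ] (side j sq)
    q-corner (inj₁ (e , _)) = sym e
    q-corner (inj₂ _)       = ≈-refl
    r-corner : ∀ {j} sq → r (θ j) ≈ [ r ∘ θ , p ∘ θ ] (side j sq)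
    r-corner (inj₁ _)       = ≈-refl
    r-corner (inj₂ (e , _)) = sym e
    s-corner : ∀ {j} sq → s (θ j) ≈ [ r ∘ θ , q ∘ θ ] (side j sq)
    s-corner (inj₁ (_ , e)) = sym e
    s-corner (inj₂ (_ , e)) = sym e

  Rectangular : Term L (X ⊎ Y) → Set _
  Rectangular t = ∀ a b u v → eval A t [ a , v ] ≈ eval A t [ b , u ] →
                  eval A t [ b , u ] ≈ eval A t [ b , v ]

  -- Terms suffice, since the constants of a polynomial can be made row variables with the same
  -- value in both rows. The additional row variable keeps the row block nonempty:
  -- `inert⇒rectangular` asks for an element `x₀` of it.
  stronglyRectangular : (∀ k (t : Term L (Fin (suc k) ⊎ Fin k)) → Rectangular t) →
                        StronglyRectangular A
  stronglyRectangular rectangular p q r s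
    (m , n , t , a , b , u , v , ep , eq , er , es) q≈r
    with support (toTerm t)
  ... | k , t₀ , θ , h =
    trans er (trans (corner b u)
      (trans (rectangular k t₁ (rows a) (rows b) (columns u) (columns v)
               (trans (sym (corner a v)) (trans (sym eq) (trans q≈r (trans er (corner b u))))))
        (trans (sym (corner b v)) (sym es))))
    where
    side : Fin k → Carrier ⊎ (Fin m ⊎ Fin n) → Fin (suc k) ⊎ Fin k
    side j = [ const (inj₁ (suc j)) , [ const (inj₁ (suc j)) , const (inj₂ j) ] ]
    t₁ = t₀ ⟪ (λ j → var (side j (θ j))) ⟫
    -- The default `inhabitant` goes to the additional slot; `u` here and `a` in `columns` fill the
    -- positions of the other block.
    rows : (Fin m → Carrier) → Fin (suc k) → Carrier
    rows c = inhabitant ∷ λ j → [ id , [ c , u ] ] (θ j)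
    columns : (Fin n → Carrier) → Fin k → Carrier
    columns d j = [ id , [ a , d ] ] (θ j)
    place : ∀ c d {c′ : Fin (suc k) → Carrier} {d′ : Fin k → Carrier} j w →
            c′ (suc j) ≈ [ id , [ c , u ] ] w → d′ j ≈ [ id , [ a , d ] ] w →
            [ id , [ c , d ] ] w ≈ [ c′ , d′ ] (side j w)
    place c d j (inj₁ _)        e _ = sym e
    place c d j (inj₂ (inj₁ _)) e _ = sym e
    place c d j (inj₂ (inj₂ _)) _ e = sym e
    corner : ∀ c d → eval (expansion A) t [ c , d ] ≈ eval A t₁ [ rows c , columns d ]
    corner c d = trans (sym (eval-toTerm t [ c , d ]))
      (trans (sym (h _))
        (trans (eval-cong t₀ λ j → place c d j (θ j) ≈-refl ≈-refl)
          (sym (eval-⟪⟫ t₀))))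

-- Syntactic congruences and their quotients

-- _~_ is the largest congruence for which P is a union of classes.

module Syntactic
  {ℓ} {L : Language ℓ} (A : Algebra L) (P : Algebra.Carrier A → Set ℓ)
  (P-resp : ∀ {p q} → Algebra._≈_ A p q → P p → P q) where

  open Algebra A

  Context : Set _
  Context = Term L (Maybe Carrier)

  plug : Context → Carrier → Carrier
  plug C p = eval A C (fromMaybe p)

  infix 4 _~_

  _~_ : Carrier → Carrier → Set _
  p ~ q = ∀ C → (P (plug C p) → P (plug C q)) × (P (plug C q) → P (plug C p))

  ≈⇒~ : ∀ {p q} → p ≈ q → p ~ q
  ≈⇒~ p≈q C = P-resp (step p≈q) , P-resp (step (sym p≈q))
    where
    step : ∀ {p q} → p ≈ q → plug C p ≈ plug C q
    step e = eval-cong A C λ { nothing → e ; (just _) → Algebra.refl A }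

  -- Since `_~_` is about one hole, the arguments are exchanged one at a time: `head` freezes the
  -- later ones at their old values, and `tail` turns the exchanged one into a constant.
  replace : ∀ n (C : Term L (Fin n ⊎ Carrier)) (as bs : Vector Carrier n) →
            (∀ i → as i ~ bs i) →
            P (eval A C [ as , id ]) → P (eval A C [ bs , id ])
  replace zero    C as bs h Pas =
    P-resp (eval-cong A C λ { (inj₂ _) → Algebra.refl A }) Pas
  replace (suc n) C as bs h Pas =
    P-resp
      (trans (eval-⟪⟫ A C) (eval-cong A C λ where
        (inj₁ zero)    → Algebra.refl A
        (inj₁ (suc _)) → Algebra.refl A
        (inj₂ _)       → Algebra.refl A))
      (replace n tail (as ∘ suc) (bs ∘ suc) (h ∘ suc)
        (P-resp (trans (eval-⟪⟫ A C) (trans (eval-cong A C λ where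
                  (inj₁ zero)    → Algebra.refl A
                  (inj₁ (suc _)) → Algebra.refl A
                  (inj₂ _)       → Algebra.refl A) (sym (eval-⟪⟫ A C))))
          (proj₁ (h zero head)
            (P-resp (sym (trans (eval-⟪⟫ A C) (eval-cong A C λ where
                      (inj₁ zero)    → Algebra.refl A
                      (inj₁ (suc _)) → Algebra.refl A
                      (inj₂ _)       → Algebra.refl A))) Pas))))
    where
    head : Context
    head = C ⟪ (λ { (inj₁ zero)    → var nothing
                  ; (inj₁ (suc i)) → var (just (as (suc i)))
                  ; (inj₂ c)       → var (just c) }) ⟫
    tail : Term L (Fin n ⊎ Carrier)
    tail = C ⟪ (λ { (inj₁ zero)    → var (inj₂ (bs zero))
                  ; (inj₁ (suc i)) → var (inj₁ i)
                  ; (inj₂ c)       → var (inj₂ c) }) ⟫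

  op-~ : ∀ f {as bs} → (∀ i → as i ~ bs i) → ∀ C →
         P (plug C (op f as)) → P (plug C (op f bs))
  op-~ f {as} {bs} h C P-as = P-resp (unfold bs) (replace _ D as bs h (P-resp (sym (unfold as)) P-as))
    where
    D : Term L (Fin (arity L f) ⊎ Carrier)
    D = C ⟪ maybe′ (var ∘ inj₂) (app f (var ∘ inj₁)) ⟫
    unfold : ∀ cs → eval A D [ cs , id ] ≈ plug C (op f cs)
    unfold cs = trans (eval-⟪⟫ A C) (eval-cong A C λ { nothing → Algebra.refl A ; (just _) → Algebra.refl A })

  quotient : Algebra L
  quotient = record
    { setoid = record
      { Carrier = Carrier
      ; _≈_ = _~_
      ; isEquivalence = record
        { refl  = λ C → id , id
        ; sym   = λ h C → swap (h C)
        ; trans = λ h k C → proj₁ (k C) ∘ proj₁ (h C) , proj₂ (h C) ∘ proj₂ (k C)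
        }
      }
    ; inhabitant = inhabitant
    ; op = op
    ; op-cong = λ f h C → op-~ f h C , op-~ f (λ i C → swap (h i C)) C
    }

  private module Q = Algebra quotient

  eval-quotient : (t : Term L X) (ρ : X → Carrier) → eval quotient t ρ ~ eval A t ρ
  eval-quotient (var v)    ρ = Q.refl
  eval-quotient (app f ts) ρ = Q.op-cong f (λ i → eval-quotient (ts i) ρ)

  quotient-∈ : ∀ V → A ∈ V → quotient ∈ V
  quotient-∈ V A∈V s t e ρ =
    Q.trans (eval-quotient s ρ) (Q.trans (≈⇒~ (A∈V s t e ρ)) (Q.sym (eval-quotient t ρ)))

-- Equational logic and free algebras

infix 4 _⊢_≈_

-- Validity in all models quantifies over algebras, so it lives one level too high to be the
-- equality of an `Algebra L`; derivability stays at level `ℓ`.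
data _⊢_≈_ {L : Language ℓ} (V : Variety L) {X : Set} : (s t : Term L X) → Set ℓ where
  axiom   : ∀ {s t} → Identity V s t → (σ : ℕ → Term L X) → V ⊢ s ⟪ σ ⟫ ≈ t ⟪ σ ⟫
  reflex  : ∀ {s} → V ⊢ s ≈ s
  symm    : ∀ {s t} → V ⊢ s ≈ t → V ⊢ t ≈ s
  transit : ∀ {s t u} → V ⊢ s ≈ t → V ⊢ t ≈ u → V ⊢ s ≈ u
  congr   : ∀ f {ss ts : Vector (Term L X) (arity L f)} →
            (∀ i → V ⊢ ss i ≈ ts i) → V ⊢ app f ss ≈ app f ts

module _ {L : Language ℓ} (V : Variety L) where

  infix 4 _⊫_≈_

  _⊫_≈_ : {X : Set} → Term L X → Term L X → Set _
  _⊫_≈_ s t = ∀ A → A ∈ V → ∀ ρ → Algebra._≈_ A (eval A s ρ) (eval A t ρ)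

Free : {L : Language ℓ} (V : Variety L) {X : Set} → X → Algebra L
Free {L = L} V {X} x₀ = record
  { setoid = record
    { Carrier = Term L X
    ; _≈_ = V ⊢_≈_
    ; isEquivalence = record { refl = reflex ; sym = symm ; trans = transit }
    }
  ; inhabitant = var x₀
  ; op = app
  ; op-cong = congr
  }

module _ {L : Language ℓ} {V : Variety L} where

  private
    variable
      U W : Set

  soundness : {s t : Term L U} → V ⊢ s ≈ t → _⊫_≈_ V s t
  soundness (axiom {s} {t} e σ) A A∈V ρ =
    trans (eval-⟪⟫ A s) (trans (A∈V s t e _) (sym (eval-⟪⟫ A t)))
    where open Algebra A
  soundness reflex          A A∈V ρ = Algebra.refl A
  soundness (symm e)        A A∈V ρ = Algebra.sym A (soundness e A A∈V ρ)
  soundness (transit e₁ e₂) A A∈V ρ =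
    Algebra.trans A (soundness e₁ A A∈V ρ) (soundness e₂ A A∈V ρ)
  soundness (congr f es)    A A∈V ρ =
    Algebra.op-cong A f (λ i → soundness (es i) A A∈V ρ)

  module _ (x₀ : U) where

    eval-Free : (t : Term L X) (σ : X → Term L U) →
                V ⊢ eval (Free V x₀) t σ ≈ t ⟪ σ ⟫
    eval-Free (var v)    σ = reflex
    eval-Free (app f ts) σ = congr f (λ i → eval-Free (ts i) σ)

    Free-∈ : Free V x₀ ∈ V
    Free-∈ s t e σ = transit (eval-Free s σ) (transit (axiom e σ) (symm (eval-Free t σ)))

    eval-generic : (t : Term L U) → V ⊢ eval (Free V x₀) t var ≈ t
    eval-generic (var v)    = reflex
    eval-generic (app f ts) = congr f (λ i → eval-generic (ts i))

    completeness : {s t : Term L U} → _⊫_≈_ V s t → V ⊢ s ≈ t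
    completeness {s} {t} h =
      transit (symm (eval-generic s)) (transit (h (Free V x₀) Free-∈ var) (eval-generic t))

  ⊢-⟪⟫ : {s t : Term L U} {σ : U → Term L W} → W → V ⊢ s ≈ t → V ⊢ s ⟪ σ ⟫ ≈ t ⟪ σ ⟫
  ⊢-⟪⟫ {s = s} {t} w₀ e = completeness w₀ λ A A∈V ρ → let open Algebra A in
    trans (eval-⟪⟫ A s) (trans (soundness e A A∈V _) (sym (eval-⟪⟫ A t)))

-- Contexts evaluated in arbitrary models, and perturbations

module _ {L : Language ℓ} (A : Algebra L) where
  open Algebra A

  fill : Term L (Maybe X) → (X → Carrier) → Carrier → Carrier
  fill C η e = eval A C (maybe′ η e)

  fill-cong : (C : Term L (Maybe X)) {η θ : X → Carrier} {d e : Carrier} →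
              (∀ v → η v ≈ θ v) → d ≈ e → fill C η d ≈ fill C θ e
  fill-cong C h d≈e = eval-cong A C λ { nothing → d≈e ; (just v) → h v }

  fill-⟪⟫ : (C : Term L (Maybe X)) {σ : X → Term L Y} {s : Term L Y}
            {η : X → Carrier} {d : Carrier} {ρ : Y → Carrier} →
            (∀ v → eval A (σ v) ρ ≈ η v) → eval A s ρ ≈ d →
            eval A (C ⟪ maybe′ σ s ⟫) ρ ≈ fill C η d
  fill-⟪⟫ C h e =
    trans (eval-⟪⟫ A C) (eval-cong A C λ { nothing → e ; (just v) → h v })

  -- A context over a free algebra has terms as parameters. Replacing them by their values moves a
  -- computation with such a context into any model.
  fill-Free : ∀ {V : Variety L} {U : Set} {x₀ : U} (C : Term L (Maybe (Term L U))) {p : Term L U}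
              (ρ : U → Carrier) →
              eval A (eval (Free V x₀) C (fromMaybe p)) ρ ≈ fill C (λ c → eval A c ρ) (eval A p ρ)
  fill-Free (var nothing)  ρ = Algebra.refl A
  fill-Free (var (just _)) ρ = Algebra.refl A
  fill-Free {V} {x₀ = x₀} (app f ts) ρ = op-cong f (λ i → fill-Free {V} {x₀ = x₀} (ts i) ρ)

  eval-⟪⟫-cong : (t : Term L X) {σ : X → Term L Y} {ρ : Y → Carrier} {η : X → Carrier} →
                 (∀ v → eval A (σ v) ρ ≈ η v) → eval A (t ⟪ σ ⟫) ρ ≈ eval A t η
  eval-⟪⟫-cong t h = trans (eval-⟪⟫ A t) (eval-cong A t h)

module _ {L : Language ℓ} (V : Variety L) where

  Perturbation : {U X : Set} → Term L U → Term L (U ⊎ (X ⊎ X)) → Set _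
  Perturbation t K = ∀ A → A ∈ V → let open Algebra A in
    ∀ ρ w → eval A K [ ρ , [ w , w ] ] ≈ eval A t ρ

  Inert : {U X : Set} → Term L U → Term L (U ⊎ (X ⊎ X)) → Set _
  Inert t K = ∀ A → A ∈ V → let open Algebra A in
    ∀ ρ w w′ → eval A K [ ρ , [ w , w′ ] ] ≈ eval A t ρ

-- From inert perturbations to rectangularity

module _ {L : Language ℓ} {V : Variety L} (V-abelian : AbelianVariety V) where

  module _ {X Y : Set} (x₀ : X) (t : Term L (X ⊎ Y))
           (inert : ∀ (K : Term L ((X ⊎ Y) ⊎ (X ⊎ X))) → Perturbation V t K → Inert V t K)
           (D : Algebra L) (D∈V : D ∈ V) where

    private
      module D = Algebra D
      U : Set
      U = X ⊎ Y

    -- Take the free algebra on two copies x, y and x′, y′ of the variables. As its quotient by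
    -- `_~_` is abelian, t(x′, y) ~ t(x′, y′) implies t(x, y) ~ t(x, y′). The first relation is
    -- `l~r`; by the second, t(x, y′) lies in `P` along with t(x, y), which includes the desired
    -- equation.
    inert⇒rectangular : Rectangular D t
    inert⇒rectangular a b u v a,v≈b,u =
      D.trans (D.sym (proj₂ (proj₁ (base~shifted (var nothing)) P-base)))
        (eval-⟪⟫-cong D t λ { (inj₁ _) → D.refl ; (inj₂ _) → D.refl })
      where
      -- This substitution sets y′ = y and leaves x, y and x′ independent.
      collapse : U ⊎ U → Term L (U ⊎ X)
      collapse = [ var ∘ inj₁ , [ var ∘ inj₂ , var ∘ inj₁ ∘ inj₂ ] ]

      l r : Term L (U ⊎ U)
      l = t ⟪ [ var ∘ inj₂ ∘ inj₁ , var ∘ inj₁ ∘ inj₂ ] ⟫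
      r = t ⟪ var ∘ inj₂ ⟫

      δ : U ⊎ U → D.Carrier
      δ = [ [ b , u ] , [ b , v ] ]

      F : Algebra L
      F = Free V {U ⊎ U} (inj₁ (inj₁ x₀))

      -- The first condition turns contexts around t(x′, y) into perturbations of `t`; the second
      -- records the value in `D` at x = x′ = b, y = u, y′ = v.
      P : Term L (U ⊎ U) → Set _
      P e = V ⊢ e ⟪ collapse ⟫ ≈ t ⟪ var ∘ inj₁ ⟫ × eval D e δ D.≈ eval D t [ b , u ]

      P-resp : ∀ {p q} → V ⊢ p ≈ q → P p → P q
      P-resp e (h₁ , h₂) =
        transit (⊢-⟪⟫ (inj₂ x₀) (symm e)) h₁ , D.trans (soundness (symm e) D D∈V δ) h₂

      open Syntactic F P P-resp

      module _ (A : Algebra L) where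
        open Algebra A

        spread : (U ⊎ X → Carrier) → U ⊎ U → Carrier
        spread ω = [ ω ∘ inj₁ , [ ω ∘ inj₂ , ω ∘ inj₁ ∘ inj₂ ] ]

        eval-collapse : ∀ p ω → eval A (p ⟪ collapse ⟫) ω ≈ eval A p (spread ω)
        eval-collapse p ω = eval-⟪⟫-cong A p λ where
          (inj₁ _)        → Algebra.refl A
          (inj₂ (inj₁ _)) → Algebra.refl A
          (inj₂ (inj₂ _)) → Algebra.refl A

        inner : (U ⊎ X → Carrier) → Carrier
        inner ω = eval A t [ ω ∘ inj₂ , ω ∘ inj₁ ∘ inj₂ ]

        eval-l : ∀ ω → eval A l (spread ω) ≈ inner ω
        eval-l ω = eval-⟪⟫-cong A t λ { (inj₁ _) → Algebra.refl A ; (inj₂ _) → Algebra.refl A }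

        eval-r : ∀ ω → eval A r (spread ω) ≈ inner ω
        eval-r ω = eval-⟪⟫-cong A t λ { (inj₁ _) → Algebra.refl A ; (inj₂ _) → Algebra.refl A }

        eval-collapse-plug : ∀ C {p} ω → eval A p (spread ω) ≈ inner ω →
          eval A (plug C p ⟪ collapse ⟫) ω ≈ fill A C (λ c → eval A c (spread ω)) (inner ω)
        eval-collapse-plug C {p} ω e =
          trans (eval-collapse (plug C p) ω)
            (trans (fill-Free A C _) (fill-cong A C (λ _ → Algebra.refl A) e))

      collapse-l≈r : ∀ C → V ⊢ plug C l ⟪ collapse ⟫ ≈ plug C r ⟪ collapse ⟫
      collapse-l≈r C = completeness (inj₂ x₀) λ A A∈V ω → let open Algebra A in
        trans (eval-collapse-plug A C ω (eval-l A ω)) (sym (eval-collapse-plug A C ω (eval-r A ω)))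

      eval-plug-l≈r : ∀ C → V ⊢ plug C l ⟪ collapse ⟫ ≈ t ⟪ var ∘ inj₁ ⟫ →
                      eval D (plug C l) δ D.≈ eval D (plug C r) δ
      eval-plug-l≈r C h =
        D.trans (fill-Free D C δ) (D.trans (fill-cong D C (λ _ → D.refl) l-value)
          (D.trans C-l≈r (D.sym (D.trans (fill-Free D C δ) (fill-cong D C (λ _ → D.refl) r-value)))))
        where
        -- The hole of `C` receives t(w, y), while in the parameters w′ stands for x′ and y for y′.
        -- At w = w′ this is the collapse of C[t(x′, y)], which is t(x, y) by `h`.
        K : Term L (U ⊎ (X ⊎ X))
        K = C ⟪ maybe′ (λ c → c ⟪ [ var ∘ inj₁ , [ var ∘ inj₂ ∘ inj₂ , var ∘ inj₁ ∘ inj₂ ] ] ⟫)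
                       (t ⟪ [ var ∘ inj₂ ∘ inj₁ , var ∘ inj₁ ∘ inj₂ ] ⟫) ⟫

        eval-K : ∀ A → let open Algebra A in ∀ ρ w w′ →
          eval A K [ ρ , [ w , w′ ] ] ≈
          fill A C (λ c → eval A c (spread A [ ρ , w′ ])) (eval A t [ w , ρ ∘ inj₂ ])
        eval-K A ρ w w′ = fill-⟪⟫ A C
          (λ c → eval-⟪⟫-cong A c λ where
            (inj₁ _)        → Algebra.refl A
            (inj₂ (inj₁ _)) → Algebra.refl A
            (inj₂ (inj₂ _)) → Algebra.refl A)
          (eval-⟪⟫-cong A t λ { (inj₁ _) → Algebra.refl A ; (inj₂ _) → Algebra.refl A })

        K-perturbation : Perturbation V t K
        K-perturbation A A∈V ρ w = let open Algebra A in
          trans (eval-K A ρ w w)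
            (trans (sym (eval-collapse-plug A C [ ρ , w ] (eval-l A [ ρ , w ])))
              (trans (soundness h A A∈V [ ρ , w ]) (eval-⟪⟫ A t)))

        K-inert : ∀ w → fill D C (λ c → eval D c (spread D [ [ b , u ] , b ])) (eval D t [ w , u ])
                        D.≈ eval D t [ b , u ]
        K-inert w = D.trans (D.sym (eval-K D [ b , u ] w b))
                            (inert K K-perturbation D D∈V [ b , u ] w b)

        J : Term L ((U ⊎ U) ⊎ U)
        J = C ⟪ maybe′ (λ c → c ⟪ var ∘ inj₁ ⟫) (t ⟪ var ∘ inj₂ ⟫) ⟫

        eval-J : ∀ η τ → eval D J [ η , τ ] D.≈ fill D C (λ c → eval D c η) (eval D t τ)
        eval-J η τ = fill-⟪⟫ D C (λ c → eval-⟪⟫ D c) (eval-⟪⟫ D t)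

        -- Inertness at w = a and at w = b gives this equality with u in place of v, both for y′ and
        -- inside the hole. The term condition changes these two occurrences to v at once.
        C-l≈r : fill D C (λ c → eval D c δ) (eval D t [ a , v ]) D.≈
                fill D C (λ c → eval D c δ) (eval D t [ b , v ])
        C-l≈r = D.trans (D.sym (eval-J _ _)) (D.trans
          (term-condition D (V-abelian D D∈V) J
            [ [ [ b , u ] , [ b , u ] ] , [ a , u ] ] [ [ [ b , u ] , [ b , u ] ] , [ b , u ] ]
            [ δ , [ a , v ] ] [ δ , [ b , v ] ]
            (λ where
              (inj₁ (inj₁ (inj₁ _))) → inj₁ (D.refl , D.refl)
              (inj₁ (inj₁ (inj₂ _))) → inj₁ (D.refl , D.refl)
              (inj₁ (inj₂ (inj₁ _))) → inj₁ (D.refl , D.refl)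
              (inj₁ (inj₂ (inj₂ _))) → inj₁ (D.refl , D.refl)
              (inj₂ (inj₁ _))        → inj₂ (D.refl , D.refl)
              (inj₂ (inj₂ _))        → inj₁ (D.refl , D.refl))
            (D.trans (eval-J _ _) (D.trans (fill-cong D C same D.refl) (D.trans (K-inert a)
              (D.trans (D.sym (K-inert b))
                (D.trans (fill-cong D C (λ c → D.sym (same c)) D.refl) (D.sym (eval-J _ _))))))))
          (eval-J _ _))
          where
          same : ∀ c → eval D c [ [ b , u ] , [ b , u ] ] D.≈ eval D c (spread D [ [ b , u ] , b ])
          same c = eval-cong D c λ where
            (inj₁ _)        → D.refl
            (inj₂ (inj₁ _)) → D.refl
            (inj₂ (inj₂ _)) → D.refl

        l-value : eval D l δ D.≈ eval D t [ a , v ]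
        l-value = D.trans
          (eval-⟪⟫-cong D t λ { (inj₁ _) → D.refl ; (inj₂ _) → D.refl }) (D.sym a,v≈b,u)

        r-value : eval D r δ D.≈ eval D t [ b , v ]
        r-value = eval-⟪⟫ D t

      l~r : l ~ r
      l~r C =
        (λ { (h₁ , h₂) → transit (symm (collapse-l≈r C)) h₁ ,
                         D.trans (D.sym (eval-plug-l≈r C h₁)) h₂ }) ,
        (λ { (h₁ , h₂) → let h = transit (collapse-l≈r C) h₁ in
                         h , D.trans (eval-plug-l≈r C h) h₂ })

      module Q = Algebra quotient

      P-base : P (t ⟪ var ∘ inj₁ ⟫)
      P-base = completeness (inj₂ x₀) (λ A A∈V ω → let open Algebra A in
          trans (eval-collapse A (t ⟪ var ∘ inj₁ ⟫) ω) (trans (eval-⟪⟫ A t) (sym (eval-⟪⟫ A t)))) ,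
        eval-⟪⟫ D t

      eval-Q : ∀ σ → eval quotient t σ ~ t ⟪ σ ⟫
      eval-Q σ = Q.trans (eval-quotient t σ) (≈⇒~ (eval-Free _ t σ))

      base~shifted : (t ⟪ var ∘ inj₁ ⟫) ~ (t ⟪ [ var ∘ inj₁ ∘ inj₁ , var ∘ inj₂ ∘ inj₂ ] ⟫)
      base~shifted = Q.trans (Q.sym (eval-Q _)) (Q.trans
        (term-condition quotient (V-abelian quotient (quotient-∈ V (Free-∈ _))) t
          [ var ∘ inj₂ ∘ inj₁ , var ∘ inj₁ ∘ inj₂ ] (var ∘ inj₂)
          (var ∘ inj₁) [ var ∘ inj₁ ∘ inj₁ , var ∘ inj₂ ∘ inj₂ ]
          (λ { (inj₁ _) → inj₁ (Q.refl , Q.refl) ; (inj₂ _) → inj₂ (Q.refl , Q.refl) })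
          (Q.trans (eval-Q _) (Q.trans l~r (Q.sym (eval-Q _)))))
        (eval-Q _))

-- New identities in a minimal variety

extend : {k : ℕ} → (Fin k → X) → X → ℕ → X
extend {k = zero}  ρ c _       = c
extend {k = suc k} ρ c zero    = ρ zero
extend {k = suc k} ρ c (suc n) = extend (ρ ∘ suc) c n

extend-toℕ : {k : ℕ} (ρ : Fin k → X) (c : X) (i : Fin k) → extend ρ c (toℕ i) ≡ ρ i
extend-toℕ ρ c zero    = refl
extend-toℕ ρ c (suc i) = extend-toℕ (ρ ∘ suc) c i

Finite : Set → Set
Finite X = ∃ λ n → X ↔ Fin n

Fin-finite : ∀ n → Finite (Fin n)
Fin-finite n = n , ↔-id _

Bool-finite : Finite Bool
Bool-finite = 2 , ↔-sym 2↔Bool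

⊎-finite : {X Y : Set} → Finite X → Finite Y → Finite (X ⊎ Y)
⊎-finite (m , f) (n , g) = m + n , ↔-sym +↔⊎ ↔-∘ (f ⊎-↔ g)

-- Otherwise the variety defined by the theory of D would be a proper
-- nontrivial subvariety.

new-identity⇒trivial :
  {L : Language ℓ} {V : Variety L} → Minimal V → {X : Set} → Finite X →
  (s t : Term L X) → ¬ (_⊫_≈_ V s t) →
  (D : Algebra L) → D ∈ V → let open Algebra D in
  (∀ ρ → eval D s ρ ≈ eval D t ρ) → ∀ a b → a ≈ b
new-identity⇒trivial {L = L} {V} minimal {X} (k , f) s t s≉t D D∈V s≈t =
  proj₂ minimal theory (theory⊆V , λ V⊆theory → s≉t (transfer V⊆theory)) D (λ _ _ e → e)
  where
  open Inverse f
  theory : Variety L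
  theory = record { Identity = D ⊨_≈̇_ }
  theory⊆V : theory ⊆ V
  theory⊆V A A∈ p q e = A∈ p q (D∈V p q e)
  -- Identities of a variety have their variables in ℕ; the numbering of the finite set `X` carries
  -- `s` and `t` there.
  index : X → Term L ℕ
  index = var ∘ toℕ ∘ to
  transfer : V ⊆ theory → _⊫_≈_ V s t
  transfer V⊆theory A A∈V ρ =
    trans (sym (eval-⟪⟫-cong A s agree)) (trans
      (V⊆theory A A∈V (s ⟪ index ⟫) (t ⟪ index ⟫)
        (λ σ → D.trans (eval-⟪⟫ D s) (D.trans (s≈t _) (D.sym (eval-⟪⟫ D t))))
        (extend (ρ ∘ from) inhabitant))
      (eval-⟪⟫-cong A t agree))
    where
    module D = Algebra D
    open Algebra A using (trans; sym; inhabitant; reflexive; _≈_)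
    agree : ∀ v → extend (ρ ∘ from) inhabitant (toℕ (to v)) ≈ ρ v
    agree v = reflexive (≡.trans (extend-toℕ (ρ ∘ from) _ (to v)) (cong ρ (strictlyInverseʳ v)))

pair : X → X → Bool → X
pair a b true  = a
pair a b false = b

module _ {L : Language ℓ} {V : Variety L} where

  eval-eval : {U : Set} {x₀ : U} (t : Term L X) {σ : X → Term L U} (A : Algebra L) → A ∈ V →
    let open Algebra A in
    ∀ ρ → eval A (eval (Free V x₀) t σ) ρ ≈ eval A t (λ v → eval A (σ v) ρ)
  eval-eval {x₀ = x₀} t {σ} A A∈V ρ =
    Algebra.trans A (soundness (eval-Free x₀ t σ) A A∈V ρ) (eval-⟪⟫ A t)

  true≉false : ¬ Trivial V → ¬ (V ⊢ var true ≈ var false)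
  true≉false nontrivial e = nontrivial λ A A∈V a b → soundness e A A∈V (pair a b)

module _ {L : Language ℓ} (V : Variety L) where

  -- The variable `false` is a spare one that a perturbation of `true` may contain: such
  -- perturbations arise by substituting terms in two generators into a larger term.
  Rigid : Set _
  Rigid = {X : Set} → Finite X → (T : Term L (Bool ⊎ (X ⊎ X))) →
          Perturbation V (var true) T → Inert V (var true) T

-- Rigid varieties are strongly abelian

module _ {L : Language ℓ} {V : Variety L} (V-abelian : AbelianVariety V)
         (rigid : Rigid V) where

  -- Substituting `ν` turns `K` into a perturbation of a single variable, inert by rigidity. Thus
  -- exchanging w for w′ changes nothing at one valuation `g` of the variables of `t`, and the term
  -- condition carries this over to every `ρ`.
  onto⇒inert : {U X : Set} → Finite X → (t : Term L U) (ν : U → Term L Bool) →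
    (∀ A → A ∈ V → let open Algebra A in
       ∀ β → eval A t (λ u → eval A (ν u) β) ≈ β true) →
    (K : Term L (U ⊎ (X ⊎ X))) → Perturbation V t K → Inert V t K
  onto⇒inert {U} {X} finite t ν onto K K-perturbation A A∈V ρ w w′ =
    A.trans (A.sym rs) (K-perturbation A A∈V ρ w)
    where
    module A = Algebra A
    T : Term L (Bool ⊎ (X ⊎ X))
    T = K ⟪ [ (λ u → ν u ⟪ var ∘ inj₁ ⟫) , var ∘ inj₂ ] ⟫
    eval-T : ∀ A → let open Algebra A in
      ∀ β w → eval A T [ β , w ] ≈ eval A K [ (λ u → eval A (ν u) β) , w ]
    eval-T A β w = eval-⟪⟫-cong A K
      λ { (inj₁ u) → eval-⟪⟫ A (ν u) ; (inj₂ _) → Algebra.refl A }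
    T-perturbation : Perturbation V (var true) T
    T-perturbation A A∈V β w = let open Algebra A in
      trans (eval-T A β [ w , w ]) (trans (K-perturbation A A∈V _ w) (onto A A∈V β))
    β : Bool → A.Carrier
    β _ = A.inhabitant
    g : U → A.Carrier
    g u = eval A (ν u) β
    T-value : ∀ w′ → eval A K [ g , [ w , w′ ] ] A.≈ A.inhabitant
    T-value w′ = A.trans (A.sym (eval-T A β [ w , w′ ])) (rigid finite T T-perturbation A A∈V β w w′)
    rs : eval A K [ ρ , [ w , w ] ] A.≈ eval A K [ ρ , [ w , w′ ] ]
    rs = term-condition A (V-abelian A A∈V) K
      [ g , [ w , w ] ] [ g , [ w , w′ ] ] [ ρ , [ w , w ] ] [ ρ , [ w , w′ ] ]
      (λ where
        (inj₁ _)        → inj₁ (A.refl , A.refl)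
        (inj₂ (inj₁ _)) → inj₁ (A.refl , A.refl)
        (inj₂ (inj₂ _)) → inj₂ (A.refl , A.refl))
      (A.trans (T-value w) (A.sym (T-value w′)))

  module _ {U X : Set} (U-finite : Finite U) (X-finite : Finite X) (x₀ : X)
           (t : Term L U) (K : Term L (U ⊎ (X ⊎ X))) (K-perturbation : Perturbation V t K) where

    private
      F : Algebra L
      F = Free V true

      P : Term L Bool → Set _
      P e = V ⊢ e ≈ var true

      P-resp : ∀ {p q} → V ⊢ p ≈ q → P p → P q
      P-resp e h = transit (symm e) h

      open Syntactic F P P-resp
      module Q = Algebra quotient

      t↑ : Term L (U ⊎ (X ⊎ X))
      t↑ = t ⟪ var ∘ inj₁ ⟫

      module _ (ν : U ⊎ (X ⊎ X) → Term L Bool) (C : Context) where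

        module _ (A : Algebra L) (A∈V : A ∈ V) (β : Bool → Algebra.Carrier A) where
          open Algebra A

          C′ : Carrier → Carrier
          C′ = fill A C (λ c → eval A c β)

          C′-cong : ∀ {d e} → d ≈ e → C′ d ≈ C′ e
          C′-cong = fill-cong A C (λ _ → Algebra.refl A)

          g : U → Carrier
          g u = eval A (ν (inj₁ u)) β

          w w′ : X → Carrier
          w  i = eval A (ν (inj₂ (inj₁ i))) β
          w′ i = eval A (ν (inj₂ (inj₂ i))) β

          eval-plug-K : eval A (plug C (eval F K ν)) β ≈ C′ (eval A K [ g , [ w , w′ ] ])
          eval-plug-K = trans (fill-Free A C β)
            (C′-cong (trans (eval-eval K A A∈V β) (eval-cong A K λ where
              (inj₁ _)        → Algebra.refl A
              (inj₂ (inj₁ _)) → Algebra.refl A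
              (inj₂ (inj₂ _)) → Algebra.refl A)))

          eval-plug-t : eval A (plug C (eval F t↑ ν)) β ≈ C′ (eval A t g)
          eval-plug-t = trans (fill-Free A C β)
            (C′-cong (trans (eval-eval t↑ A A∈V β) (eval-⟪⟫ A t)))

        module _ (hyp : P (plug C (eval F K ν))) where

          -- Here w is the row block and w′ belongs to the columns, so that rectangularity can
          -- compare K(u, w, w) with K(u, w, w′) inside `C`.
          s : Term L (X ⊎ (X ⊎ (U ⊎ Bool)))
          s = C ⟪ maybe′ (λ c → c ⟪ var ∘ inj₂ ∘ inj₂ ∘ inj₂ ⟫)
                         (K ⟪ [ var ∘ inj₂ ∘ inj₂ ∘ inj₁ , [ var ∘ inj₁ , var ∘ inj₂ ∘ inj₁ ] ] ⟫) ⟫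

          eval-s : ∀ A → let open Algebra A in ∀ w w′ ρ β →
            eval A s [ w , [ w′ , [ ρ , β ] ] ] ≈ fill A C (λ c → eval A c β) (eval A K [ ρ , [ w , w′ ] ])
          eval-s A w w′ ρ β = fill-⟪⟫ A C (λ c → eval-⟪⟫ A c) (eval-⟪⟫-cong A K λ where
            (inj₁ _)        → Algebra.refl A
            (inj₂ (inj₁ _)) → Algebra.refl A
            (inj₂ (inj₂ _)) → Algebra.refl A)

          ν′ : X ⊎ (X ⊎ (U ⊎ Bool)) → Term L Bool
          ν′ = [ ν ∘ inj₂ ∘ inj₁ , [ ν ∘ inj₂ ∘ inj₂ , [ ν ∘ inj₁ , var ] ] ]

          s-onto : ∀ A → A ∈ V → let open Algebra A in
                   ∀ β → eval A s (λ v → eval A (ν′ v) β) ≈ β true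
          s-onto A A∈V β = let open Algebra A in
            trans (eval-cong A s λ where
              (inj₁ _)               → Algebra.refl A
              (inj₂ (inj₁ _))        → Algebra.refl A
              (inj₂ (inj₂ (inj₁ _))) → Algebra.refl A
              (inj₂ (inj₂ (inj₂ _))) → Algebra.refl A)
            (trans (eval-s A (w A A∈V β) (w′ A A∈V β) (g A A∈V β) β)
              (trans (sym (eval-plug-K A A∈V β)) (soundness hyp A A∈V β)))

          -- By hypothesis `s` takes every value, so its perturbations are inert and it is
          -- rectangular. Both s(w′, w′) and s(w, w) equal C[t], hence so does s(w, w′), which is
          -- C[K].
          P-K⇒P-t : P (plug C (eval F t↑ ν))
          P-K⇒P-t = transit (completeness true K≈t) hyp
            where
            K≈t : _⊫_≈_ V (plug C (eval F t↑ ν)) (plug C (eval F K ν))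
            K≈t A A∈V β =
              trans (eval-plug-t A A∈V β) (trans (sym (diagonal b)) (trans (sym (eval-s A b b _ β))
                (trans
                  (inert⇒rectangular V-abelian x₀ s
                    (onto⇒inert X-finite s ν′ s-onto) A A∈V a b
                    [ b , [ g A A∈V β , β ] ] [ a , [ g A A∈V β , β ] ]
                    (trans (eval-s A a a _ β) (trans (diagonal a)
                      (trans (sym (diagonal b)) (sym (eval-s A b b _ β))))))
                  (trans (eval-s A b a _ β) (sym (eval-plug-K A A∈V β))))))
              where
              open Algebra A using (trans; sym; Carrier; _≈_)
              a b : X → Carrier
              a = w′ A A∈V β
              b = w A A∈V β
              diagonal : ∀ w → C′ A A∈V β (eval A K [ g A A∈V β , [ w , w ] ]) ≈
                               C′ A A∈V β (eval A t (g A A∈V β))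
              diagonal w = C′-cong A A∈V β (K-perturbation A A∈V _ w)

        module _ (hyp : P (plug C (eval F t↑ ν))) where

          s′ : Term L (U ⊎ Bool)
          s′ = C ⟪ maybe′ (λ c → c ⟪ var ∘ inj₂ ⟫) (t ⟪ var ∘ inj₁ ⟫) ⟫

          eval-s′ : ∀ A → let open Algebra A in ∀ ρ →
            eval A s′ ρ ≈ fill A C (λ c → eval A c (ρ ∘ inj₂)) (eval A t (ρ ∘ inj₁))
          eval-s′ A ρ = fill-⟪⟫ A C (λ c → eval-⟪⟫ A c) (eval-⟪⟫ A t)

          K′ : Term L ((U ⊎ Bool) ⊎ (X ⊎ X))
          K′ = C ⟪ maybe′ (λ c → c ⟪ var ∘ inj₁ ∘ inj₂ ⟫) (K ⟪ [ var ∘ inj₁ ∘ inj₁ , var ∘ inj₂ ] ⟫) ⟫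

          eval-K′ : ∀ A → let open Algebra A in ∀ ρ w →
            eval A K′ [ ρ , w ] ≈ fill A C (λ c → eval A c (ρ ∘ inj₂)) (eval A K [ ρ ∘ inj₁ , w ])
          eval-K′ A ρ w = fill-⟪⟫ A C (λ c → eval-⟪⟫ A c)
            (eval-⟪⟫-cong A K λ { (inj₁ _) → Algebra.refl A ; (inj₂ _) → Algebra.refl A })

          K′-perturbation : Perturbation V s′ K′
          K′-perturbation A A∈V ρ w = let open Algebra A in
            trans (eval-K′ A ρ [ w , w ])
              (trans (fill-cong A C (λ _ → Algebra.refl A) (K-perturbation A A∈V _ w)) (sym (eval-s′ A ρ)))

          s′-onto : ∀ A → A ∈ V → let open Algebra A in
                    ∀ β → eval A s′ (λ v → eval A ([ ν ∘ inj₁ , var ] v) β) ≈ β true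
          s′-onto A A∈V β = let open Algebra A in
            trans (eval-s′ A _) (trans (sym (eval-plug-t A A∈V β)) (soundness hyp A A∈V β))

          -- Now C[t] itself takes every value, and C[K] is a perturbation of it, hence inert.
          P-t⇒P-K : P (plug C (eval F K ν))
          P-t⇒P-K = transit (completeness true K≈t) hyp
            where
            K≈t : _⊫_≈_ V (plug C (eval F K ν)) (plug C (eval F t↑ ν))
            K≈t A A∈V β = let open Algebra A in
              trans (eval-plug-K A A∈V β)
                (trans (sym (eval-K′ A [ g A A∈V β , β ] [ w A A∈V β , w′ A A∈V β ]))
                  (trans (onto⇒inert X-finite s′ [ ν ∘ inj₁ , var ] s′-onto K′ K′-perturbation A A∈V
                           [ g A A∈V β , β ] (w A A∈V β) (w′ A A∈V β))
                    (trans (eval-s′ A [ g A A∈V β , β ]) (sym (eval-plug-t A A∈V β)))))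

      quotient-⊨ : ∀ ν → eval quotient K ν Q.≈ eval quotient t↑ ν
      quotient-⊨ ν = Q.trans (eval-quotient K ν)
        (Q.trans (λ C → P-K⇒P-t ν C , P-t⇒P-K ν C) (Q.sym (eval-quotient t↑ ν)))

    -- If K ≈ t failed in `V`, it would be a new identity of the quotient, making the quotient
    -- trivial by minimality. But `P` is the class of x, so x ~ y would give x ≈ y in `V`.
    rigid⇒inert : (∀ {p} → ExcludedMiddle p) → Minimal V → Inert V t K
    rigid⇒inert em minimal with em {P = _⊫_≈_ V K t↑}
    ... | yes h = λ A A∈V ρ w w′ → Algebra.trans A (h A A∈V _) (eval-⟪⟫ A t)
    ... | no ¬h = contradiction (symm (proj₁ (true~false (var nothing)) reflex)) (true≉false (proj₁ minimal))
      where
      true~false : var true ~ var false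
      true~false = new-identity⇒trivial minimal (⊎-finite U-finite (⊎-finite X-finite X-finite))
        K t↑ ¬h quotient (quotient-∈ V (Free-∈ true)) quotient-⊨ (var true) (var false)

  rigid⇒stronglyRectangular : (∀ {p} → ExcludedMiddle p) → Minimal V →
                              ∀ A → A ∈ V → StronglyRectangular A
  rigid⇒stronglyRectangular em minimal A A∈V = stronglyRectangular A λ k t →
    inert⇒rectangular V-abelian zero t
      (λ K K-perturbation → rigid⇒inert
        (⊎-finite (Fin-finite (suc k)) (Fin-finite k)) (Fin-finite (suc k)) zero
        t K K-perturbation em minimal)
      A A∈V

-- A Maltsev term from a perturbation that is not inert

module _ {L : Language ℓ} {V : Variety L} (V-abelian : AbelianVariety V) {X : Set} where

  -- Suppressing c, both T(T(a, w′, w′), w′, w) and T(T(a, w′, w), w′, w′) equal T(a, w′, w). The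
  -- term condition changes the first w′ of each to w, so T(T(a, w, w′), w′, w) equals T(T(a, w, w),
  -- w′, w′), which is a.
  perturbation-inverse :
    (T : Term L (Bool ⊎ (X ⊎ X))) → Perturbation V (var true) T →
    ∀ A → A ∈ V → let open Algebra A in
    ∀ a c w w′ → eval A T [ pair (eval A T [ pair a c , [ w , w′ ] ]) c , [ w′ , w ] ] ≈ a
  perturbation-inverse T T-perturbation A A∈V a c w w′ =
    trans (sym (eval-S w w′ w′ w)) (trans
      (term-condition A (V-abelian A A∈V) S
        (valuation w′ w′ w′ w) (valuation w′ w w′ w′) (valuation w w′ w′ w) (valuation w w w′ w′)
        (λ where
          (inj₁ _)               → inj₁ (Algebra.refl A , Algebra.refl A)
          (inj₂ (inj₁ (inj₁ _))) → inj₁ (Algebra.refl A , Algebra.refl A)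
          (inj₂ (inj₁ (inj₂ _))) → inj₂ (Algebra.refl A , Algebra.refl A)
          (inj₂ (inj₂ (inj₁ _))) → inj₁ (Algebra.refl A , Algebra.refl A)
          (inj₂ (inj₂ (inj₂ _))) → inj₂ (Algebra.refl A , Algebra.refl A))
        (trans (eval-S w′ w′ w′ w) (trans (T-cong (unperturbed a w′))
          (sym (trans (eval-S w′ w w′ w′) (unperturbed _ w′))))))
      (trans (eval-S w w w′ w′) (trans (unperturbed _ w′) (unperturbed a w))))
    where
    open Algebra A
    S : Term L (Bool ⊎ ((X ⊎ X) ⊎ (X ⊎ X)))
    S = T ⟪ [ pair (T ⟪ [ var ∘ inj₁ , var ∘ inj₂ ∘ inj₁ ] ⟫) (var (inj₁ false)) , var ∘ inj₂ ∘ inj₂ ] ⟫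
    valuation : (w₁ w₂ w₃ w₄ : X → Carrier) → Bool ⊎ ((X ⊎ X) ⊎ (X ⊎ X)) → Carrier
    valuation w₁ w₂ w₃ w₄ = [ pair a c , [ [ w₁ , w₂ ] , [ w₃ , w₄ ] ] ]
    eval-S : ∀ w₁ w₂ w₃ w₄ → eval A S (valuation w₁ w₂ w₃ w₄) ≈
             eval A T [ pair (eval A T [ pair a c , [ w₁ , w₂ ] ]) c , [ w₃ , w₄ ] ]
    eval-S w₁ w₂ w₃ w₄ = eval-⟪⟫-cong A T λ where
      (inj₁ true)  → eval-⟪⟫-cong A T λ { (inj₁ _) → Algebra.refl A ; (inj₂ _) → Algebra.refl A }
      (inj₁ false) → Algebra.refl A
      (inj₂ _)     → Algebra.refl A
    unperturbed : ∀ d w → eval A T [ pair d c , [ w , w ] ] ≈ d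
    unperturbed d w = T-perturbation A A∈V (pair d c) w
    T-cong : ∀ {d e w} → d ≈ e → eval A T [ pair d c , w ] ≈ eval A T [ pair e c , w ]
    T-cong d≈e = eval-cong A T λ where
      (inj₁ true)  → d≈e
      (inj₁ false) → Algebra.refl A
      (inj₂ _)     → Algebra.refl A

  module _ (X-finite : Finite X) (T : Term L (Bool ⊎ (X ⊎ X)))
           (T-perturbation : Perturbation V (var true) T) where

    private
      F : Algebra L
      F = Free V true

      -- A leaf just (p , q) of M stands for the two parameters p and q: the
      -- first ones turn M into the identity map, the second ones into a map
      -- sending e to the generator var true.

      P : Term L Bool → Set _
      P e = Σ[ M ∈ Term L (Maybe (Term L Bool × Term L Bool)) ]
              V ⊢ M ⟪ maybe′ (λ pq → proj₁ pq ⟪ var ∘ just ⟫) (var nothing) ⟫ ≈ var (nothing {A = Bool}) ×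
              V ⊢ M ⟪ maybe′ proj₂ e ⟫ ≈ var true

      P-resp : ∀ {p q} → V ⊢ p ≈ q → P p → P q
      P-resp {p} {q} e (M , h₁ , h₂) = M , h₁ , transit (completeness true q≈p) h₂
        where
        q≈p : _⊫_≈_ V (M ⟪ maybe′ proj₂ q ⟫) (M ⟪ maybe′ proj₂ p ⟫)
        q≈p A A∈V β = Algebra.trans A
          (fill-⟪⟫ A M (λ _ → Algebra.refl A) (soundness (symm e) A A∈V β))
          (Algebra.sym A (fill-⟪⟫ A M (λ _ → Algebra.refl A) (Algebra.refl A)))

      open Syntactic F P P-resp
      module Q = Algebra quotient

      module _ (C : Context) (z c : Term L Bool) (ω ω′ : X → Term L Bool) where

        Tz : Term L Bool
        Tz = T ⟪ [ pair z c , [ ω , ω′ ] ] ⟫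

        module _ (M : Term L (Maybe (Term L Bool × Term L Bool)))
                 (h₁ : V ⊢ M ⟪ maybe′ (λ pq → proj₁ pq ⟪ var ∘ just ⟫) (var nothing) ⟫ ≈ var (nothing {A = Bool}))
                 (h₂ : V ⊢ M ⟪ maybe′ proj₂ (plug C z) ⟫ ≈ var true) where

          -- This is the second map of `M` applied to C[T(z, w, w′)]. At w = w′ it reduces to the
          -- second map at C[z], which is x by `h₂`; so it is a perturbation of x.
          N : Term L (Bool ⊎ (X ⊎ X))
          N = M ⟪ maybe′ (λ pq → proj₂ pq ⟪ var ∘ inj₁ ⟫)
                (C ⟪ maybe′ (λ d → d ⟪ var ∘ inj₁ ⟫)
                  (T ⟪ [ pair (z ⟪ var ∘ inj₁ ⟫) (c ⟪ var ∘ inj₁ ⟫) , var ∘ inj₂ ] ⟫) ⟫) ⟫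

          eval-N : ∀ A → let open Algebra A in ∀ β w →
            eval A N [ β , w ] ≈
            fill A M (λ pq → eval A (proj₂ pq) β)
              (fill A C (λ d → eval A d β) (eval A T [ pair (eval A z β) (eval A c β) , w ]))
          eval-N A β w = fill-⟪⟫ A M (λ pq → eval-⟪⟫ A (proj₂ pq))
            (fill-⟪⟫ A C (λ d → eval-⟪⟫ A d) (eval-⟪⟫-cong A T λ where
              (inj₁ true)  → eval-⟪⟫ A z
              (inj₁ false) → eval-⟪⟫ A c
              (inj₂ _)     → Algebra.refl A))

          N-perturbation : Perturbation V (var true) N
          N-perturbation A A∈V β w = let open Algebra A in
            trans (eval-N A β [ w , w ]) (trans
              (fill-cong A M (λ _ → Algebra.refl A)
                (trans (fill-cong A C (λ _ → Algebra.refl A) (T-perturbation A A∈V (pair _ _) w))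
                  (sym (fill-Free A C β))))
              (trans (sym (fill-⟪⟫ A M (λ _ → Algebra.refl A) (Algebra.refl A))) (soundness h₂ A A∈V β)))

          -- With the first parameters this is N(M, ω, ω), the same map as `M`. With the second it
          -- is N(M, ω′, ω); since `M` sends C[T(z, ω, ω′)] to N(x, ω, ω′), the outer `N` undoes the
          -- change and returns x.
          M′ : Term L (Maybe (Term L Bool × Term L Bool))
          M′ = N ⟪ [ pair M (var (just (var false , var false))) ,
                     [ (λ i → var (just (ω i , ω′ i))) , (λ i → var (just (ω i , ω i))) ] ] ⟫

          fill-M′ : ∀ A → let open Algebra A in ∀ η e →
            fill A M′ η e ≈
            eval A N [ pair (fill A M η e) (η (var false , var false)) ,
                       [ (λ i → η (ω i , ω′ i)) , (λ i → η (ω i , ω i)) ] ]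
          fill-M′ A η e = eval-⟪⟫-cong A N λ where
            (inj₁ true)     → Algebra.refl A
            (inj₁ false)    → Algebra.refl A
            (inj₂ (inj₁ _)) → Algebra.refl A
            (inj₂ (inj₂ _)) → Algebra.refl A

          N-cong : ∀ A → let open Algebra A in ∀ {d e b w} → d ≈ e →
                   eval A N [ pair d b , w ] ≈ eval A N [ pair e b , w ]
          N-cong A d≈e = eval-cong A N λ where
            (inj₁ true)  → d≈e
            (inj₁ false) → Algebra.refl A
            (inj₂ _)     → Algebra.refl A

          M′-identity : V ⊢ M′ ⟪ maybe′ (λ pq → proj₁ pq ⟪ var ∘ just ⟫) (var nothing) ⟫ ≈ var (nothing {A = Bool})
          M′-identity = completeness nothing λ A A∈V ρ → let open Algebra A in
            trans (fill-⟪⟫ A M′ (λ pq → eval-⟪⟫ A (proj₁ pq)) (Algebra.refl A)) (trans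
              (fill-M′ A (λ pq → eval A (proj₁ pq) (ρ ∘ just)) (ρ nothing))
              (trans (N-perturbation A A∈V (pair _ _) _)
                (trans (sym (fill-⟪⟫ A M (λ pq → eval-⟪⟫ A (proj₁ pq)) (Algebra.refl A)))
                  (soundness h₁ A A∈V ρ))))

          M′-moves : V ⊢ M′ ⟪ maybe′ proj₂ (plug C Tz) ⟫ ≈ var true
          M′-moves = completeness true λ A A∈V β → let open Algebra A in
            trans (fill-⟪⟫ A M′ (λ _ → Algebra.refl A) (Algebra.refl A)) (trans
              (fill-M′ A (λ pq → eval A (proj₂ pq) β) (eval A (plug C Tz) β))
              (trans
                (N-cong A (trans
                  (fill-cong A M (λ _ → Algebra.refl A)
                    (trans (fill-Free A C β) (fill-cong A C (λ _ → Algebra.refl A)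
                      (eval-⟪⟫-cong A T λ where
                        (inj₁ true)     → Algebra.refl A
                        (inj₁ false)    → Algebra.refl A
                        (inj₂ (inj₁ _)) → Algebra.refl A
                        (inj₂ (inj₂ _)) → Algebra.refl A))))
                  (trans (sym (eval-N A β _)) (eval-cong A N λ where
                    (inj₁ true)  → Algebra.refl A
                    (inj₁ false) → Algebra.refl A
                    (inj₂ _)     → Algebra.refl A))))
                (perturbation-inverse N N-perturbation A A∈V (β true) (β false)
                  (λ i → eval A (ω i) β) (λ i → eval A (ω′ i) β))))

        P-perturb : P (plug C z) → P (plug C Tz)
        P-perturb (M , h₁ , h₂) = M′ M h₁ h₂ , M′-identity M h₁ h₂ , M′-moves M h₁ h₂

      T↑ : Term L (Bool ⊎ (X ⊎ X))
      T↑ = var (inj₁ true)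

      -- `P-perturb` yields both directions, because perturbing T(z, ω, ω′) again with ω and ω′
      -- exchanged returns z.
      T~ : ∀ ν → eval F T ν ~ ν (inj₁ true)
      T~ ν C =
        (λ h → proj₁ (≈⇒~ undo C) (P-perturb C (eval F T ν) c ω′ ω h)) ,
        (λ h → proj₁ (≈⇒~ perturb C) (P-perturb C z c ω ω′ h))
        where
        z c : Term L Bool
        z = ν (inj₁ true)
        c = ν (inj₁ false)
        ω ω′ : X → Term L Bool
        ω  = ν ∘ inj₂ ∘ inj₁
        ω′ = ν ∘ inj₂ ∘ inj₂
        unpack : ∀ A → let open Algebra A in A ∈ V → ∀ β →
                 eval A (eval F T ν) β ≈
                 eval A T [ pair (eval A z β) (eval A c β) , [ (λ i → eval A (ω i) β) , (λ i → eval A (ω′ i) β) ] ]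
        unpack A A∈V β = Algebra.trans A (eval-eval T A A∈V β) (eval-cong A T λ where
          (inj₁ true)     → Algebra.refl A
          (inj₁ false)    → Algebra.refl A
          (inj₂ (inj₁ _)) → Algebra.refl A
          (inj₂ (inj₂ _)) → Algebra.refl A)
        perturb : V ⊢ Tz C z c ω ω′ ≈ eval F T ν
        perturb = completeness true λ A A∈V β → let open Algebra A in
          trans (eval-⟪⟫-cong A T λ where
            (inj₁ true)     → Algebra.refl A
            (inj₁ false)    → Algebra.refl A
            (inj₂ (inj₁ _)) → Algebra.refl A
            (inj₂ (inj₂ _)) → Algebra.refl A)
          (sym (unpack A A∈V β))
        undo : V ⊢ Tz C (eval F T ν) c ω′ ω ≈ z
        undo = completeness true λ A A∈V β → let open Algebra A in
          trans (eval-⟪⟫-cong A T λ where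
            (inj₁ true)     → unpack A A∈V β
            (inj₁ false)    → Algebra.refl A
            (inj₂ (inj₁ _)) → Algebra.refl A
            (inj₂ (inj₂ _)) → Algebra.refl A)
          (perturbation-inverse T T-perturbation A A∈V _ _ _ _)

      quotient-⊨ : ∀ ν → eval quotient T ν Q.≈ eval quotient T↑ ν
      quotient-⊨ ν = Q.trans (eval-quotient T ν) (T~ ν)

    -- The second map of `M` takes y to x. With the first argument of `m` in the hole and the third
    -- and second as x and y, this says m(b, b, a) ≈ a; the other Maltsev law comes from comparison
    -- with the first map, the identity.
    moving⇒maltsev : P (var false) → ∀ A → A ∈ V → Affine A
    moving⇒maltsev (M , h₁ , h₂) A A∈V = V-abelian A A∈V , m , λ a b →
      trans (eval-m a b b) (trans (second≈first a b) (first-identity b b a)) ,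
      trans (eval-m b b a) (second-moves a b)
      where
      open Algebra A
      m : Term L (Fin 3)
      m = M ⟪ maybe′ (λ pq → proj₂ pq ⟪ pair (var (suc (suc zero))) (var (suc zero)) ⟫) (var zero) ⟫
      first second : Carrier → Carrier → Carrier → Carrier
      first  a b = fill A M (λ pq → eval A (proj₁ pq) (pair a b))
      second a b = fill A M (λ pq → eval A (proj₂ pq) (pair a b))
      eval-m : ∀ a b c → eval A m (a ∷ b ∷ c ∷ []) ≈ second c b a
      eval-m a b c = fill-⟪⟫ A M
        (λ pq → eval-⟪⟫-cong A (proj₂ pq) λ { true → Algebra.refl A ; false → Algebra.refl A })
        (Algebra.refl A)
      first-identity : ∀ a b e → first a b e ≈ e
      first-identity a b e = trans (sym (fill-⟪⟫ A M (λ pq → eval-⟪⟫ A (proj₁ pq)) (Algebra.refl A)))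
                                   (soundness h₁ A A∈V (maybe′ (pair a b) e))
      second-moves : ∀ a b → second a b b ≈ a
      second-moves a b = trans (sym (fill-⟪⟫ A M (λ _ → Algebra.refl A) (Algebra.refl A)))
                               (soundness h₂ A A∈V (pair a b))
      -- For x = y = b the two maps agree at b, and the term condition moves the content of the hole
      -- from b to a.
      second≈first : ∀ a b → second b b a ≈ first b b a
      second≈first a b = term-condition A (V-abelian A A∈V) M
        (maybe′ (λ pq → eval A (proj₂ pq) (pair b b)) b) (maybe′ (λ pq → eval A (proj₁ pq) (pair b b)) b)
        (maybe′ (λ pq → eval A (proj₂ pq) (pair b b)) a) (maybe′ (λ pq → eval A (proj₁ pq) (pair b b)) a)
        (λ { nothing → inj₁ (Algebra.refl A , Algebra.refl A) ; (just _) → inj₂ (Algebra.refl A , Algebra.refl A) })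
        (trans (second-moves b b) (sym (first-identity b b b)))

    -- The identity T ≈ z holds in the quotient and fails in `V`, so minimality forces x ~ y. The
    -- bare hole witnesses that x lies in `P`; hence y does too.
    nonrigid⇒affine : Minimal V → ¬ Inert V (var true) T → AffineVariety V
    nonrigid⇒affine minimal ¬inert = moving⇒maltsev
      (proj₁ (true~false (var nothing)) (var nothing , reflex , reflex))
      where
      true~false : var true ~ var false
      true~false = new-identity⇒trivial minimal (⊎-finite Bool-finite (⊎-finite X-finite X-finite))
        T T↑ (λ h → ¬inert λ A A∈V ρ w w′ → h A A∈V _)
        quotient (quotient-∈ V (Free-∈ true)) quotient-⊨ (var true) (var false)

corollary3p14 : (∀ {p} → ExcludedMiddle p) →
    (∀ {a b} → Extensionality a b) →
    ∀ {ℓ} (L : Language ℓ) (V : Variety L) →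
    Minimal V → AbelianVariety V →
    AffineVariety V ⊎ StronglyAbelianVariety V
corollary3p14 em _ L V minimal V-abelian
  with em {P = Σ[ X ∈ Set ] Finite X × Σ[ T ∈ Term L (Bool ⊎ (X ⊎ X)) ]
                 Perturbation V (var true) T × ¬ Inert V (var true) T}
... | yes (X , X-finite , T , T-perturbation , ¬inert) =
  inj₁ (nonrigid⇒affine V-abelian X-finite T T-perturbation minimal ¬inert)
... | no none = inj₂ λ A A∈V →
  V-abelian A A∈V , rigid⇒stronglyRectangular V-abelian rigid em minimal A A∈V
  where
  rigid : Rigid V
  rigid {X} finite T T-perturbation = decidable-stable em λ ¬inert →
    none (X , finite , T , T-perturbation , ¬inert)
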